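{- For every integer $k\ge 1$, each optimal solution of $G(2k+1,2k+1)$ corresponds to a permutation of the set $\{1,3,\dots,2k+1\}$. More precisely, if $S$ is an optimal solution of $G(2k+1,2k+1)$ and, for each odd $j\in\{1,3,\dots,2k+1\}$, $i_j$ denotes the unique row occupied by the cell of $S$ in column $j$ (each odd column contains exactly one cell of $S$), then $i_1i_3\cdots i_{2k+1}$ is a permutation of $\{1,3,\dots,2k+1\}$.
   Context: For integers $n,m\ge 1$, the grid $G(n,m)$ has cell set $V_{n,m}=\{(i,j): 1\le i\le n,\ 1\le j\le m\}$ ($i$ = row, $j$ = column). Contamination rules: a cell $u=(i,j)\in V_{n,m}$ can be contaminated by two contaminated cells $v,w\in V_{n,m}$ if one of the following holds: (a) $v=(i-1,j-1)$, $w=(i+1,j+1)$; (b) $v=(i+1,j-1)$, $w=(i-1,j+1)$; (c) $v=(i-1,j)$, $w=(i+1,j)$; (d) $v=(i,j-1)$, $w=(i,j+1)$; (e) $v=(i,j-1)$, $w=(i-1,j)$; (f) $v=(i,j-1)$, $w=(i+1,j)$; (g) $v=(i+1,j)$, $w=(i,j+1)$; (h) $v=(i-1,j)$, $w=(i,j+1)$. For $S\subseteq V_{n,m}$, the final contaminated set $C(S)$ is the smallest subset of $V_{n,m}$ containing $S$ and closed under rules (a)--(h). $S$ is a contaminating set if $C(S)=V_{n,m}$. The power contamination number $\gamma_c(G(n,m))$ is the minimum cardinality of a contaminating set; a contaminating set of this cardinality is an optimal solution. -}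

module Defs where

open import Data.Fin.Base using (Fin; toℕ; combine)
open import Data.Fin.Subset using (Subset; _∈_; ∣_∣)
open import Data.List.Base using (List; applyUpTo)
open import Data.Nat.Base using (ℕ; suc; _+_; _*_; _∸_; _≤_)
open import Data.Product.Base using (_×_; _,_; ∃-syntax)
open import Level using (0ℓ)
open import Relation.Binary.PropositionalEquality.Core using (_≡_)
open import Relation.Unary using (Pred)

-- Rule (i , j) v w : position (i , j) can be contaminated by v and w.
-- It is only ever applied to coordinates of cells, which are at least 1, so
-- i ∸ 1 = 0 never matches the row of a cell (and likewise for j).
data Rule : (u v w : ℕ × ℕ) → Set where
  rule-a : ∀ {i j} → Rule (i , j) (i ∸ 1 , j ∸ 1) (i + 1 , j + 1)
  rule-b : ∀ {i j} → Rule (i , j) (i + 1 , j ∸ 1) (i ∸ 1 , j + 1)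
  rule-c : ∀ {i j} → Rule (i , j) (i ∸ 1 , j)     (i + 1 , j)
  rule-d : ∀ {i j} → Rule (i , j) (i , j ∸ 1)     (i , j + 1)
  rule-e : ∀ {i j} → Rule (i , j) (i , j ∸ 1)     (i ∸ 1 , j)
  rule-f : ∀ {i j} → Rule (i , j) (i , j ∸ 1)     (i + 1 , j)
  rule-g : ∀ {i j} → Rule (i , j) (i + 1 , j)     (i , j + 1)
  rule-h : ∀ {i j} → Rule (i , j) (i ∸ 1 , j)     (i , j + 1)

module Grid (n m : ℕ) where

  Cell : Set
  Cell = Fin n × Fin m

  -- Rows and columns are numbered from 1.
  coords : Cell → ℕ × ℕ
  coords (a , b) = suc (toℕ a) , suc (toℕ b)

  -- Sets of cells, via the library's bijection Fin n × Fin m ↔ Fin (n * m);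
  -- this makes the library's cardinality ∣_∣ available.
  CellSet : Set
  CellSet = Subset (n * m)

  infix 4 _∈ᵍ_

  _∈ᵍ_ : Cell → CellSet → Set
  (a , b) ∈ᵍ S = combine a b ∈ S

  Closed : Pred Cell 0ℓ → Set
  Closed P = ∀ {u v w} → Rule (coords u) (coords v) (coords w) → P v → P w → P u

  data C (S : CellSet) : Pred Cell 0ℓ where
    initial : ∀ {u} → u ∈ᵍ S → C S u
    spread  : Closed (C S)

  C-smallest : ∀ (S : CellSet) {P : Pred Cell 0ℓ} →
               (∀ {u} → u ∈ᵍ S → P u) → Closed P → ∀ {u} → C S u → P u
  C-smallest S S⊆P closed (initial u∈S)  = S⊆P u∈S
  C-smallest S S⊆P closed (spread r v w) =
    closed r (C-smallest S S⊆P closed v) (C-smallest S S⊆P closed w)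

  Contaminating : CellSet → Set
  Contaminating S = ∀ u → C S u

  -- γ is the power contamination number γ_c(G(n,m)).
  record IsPowerContaminationNumber (γ : ℕ) : Set where
    field
      attained : ∃[ S ] Contaminating S × ∣ S ∣ ≡ γ
      minimal  : ∀ S → Contaminating S → γ ≤ ∣ S ∣

  OptimalSolution : CellSet → Set
  OptimalSolution S = Contaminating S × IsPowerContaminationNumber ∣ S ∣

  -- S contains the cell in row i and column j, for i and j numbered from 1.
  Occupied : CellSet → (i j : ℕ) → Set
  Occupied S i j = ∃[ u ] coords u ≡ (i , j) × u ∈ᵍ S

-- 1, 3, …, 2k+1
odds : ℕ → List ℕ
odds k = applyUpTo (λ t → 2 * t + 1) (suc k)

{-# OPTIONS --safe #-}

-- Two adjacent empty lines (rows or columns) stay empty for ever, as does an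
-- empty border line.  With lines numbered from 0 to 2k, every contaminating set
-- therefore meets each of the k + 1 blocks {0}, {1,2}, …, {2k-1,2k} and each of
-- the k + 1 blocks {0,1}, …, {2k-2,2k-1}, {2k}.  Since the k + 1 cells (2t , 2t)
-- contaminate the grid, an optimal solution has exactly one cell in each block
-- of either kind.  Going through the blocks alternately, it has exactly one cell
-- in each even line and none in the odd ones.
module Submission where

open import Data.Nat.Base using (ℕ; _+_; _*_; _≥_)
open import Data.List.Base using (map)
open import Data.List.Membership.Propositional using (_∈_)
open import Data.List.Relation.Binary.Permutation.Propositional using (_↭_)
open import Data.Product using (_×_; ∃!)
open import Relation.Binary.PropositionalEquality using (_≡_)
open import Defs

open import Data.Bool.Base using (true; false)
open import Data.Fin.Base using (Fin; zero; suc; toℕ; fromℕ<; combine)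
open import Data.Fin.Properties using (toℕ<n; toℕ-fromℕ<; toℕ-injective; combine-injective)
  renaming (_≟_ to _≟ᶠ_; suc-injective to suc-injectiveᶠ; 0≢1+n to 0≢1+nᶠ)
open import Data.Fin.Subset using (Subset; ⁅_⁆; _∪_; _-_; ⊥; ∣_∣) renaming (_∈_ to _∈ˢ_)
open import Data.Fin.Subset.Properties
  using (∣⊥∣≡0; ∣⁅x⁆∣≡1; p⊆p∪q; q⊆p∪q; x∈⁅x⁆; x∈p⇒∣p-x∣<∣p∣; x∈p∧x≢y⇒x∈p-y)
open import Data.List.Membership.Propositional.Properties
  using (∈-applyUpTo⁺; ∈-applyUpTo⁻; ∈-map⁺; ∈-map⁻)
open import Data.List.Membership.Propositional.Properties.WithK using (unique∧set⇒bag)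
open import Data.List.Properties using (map-applyUpTo)
open import Data.List.Relation.Binary.BagAndSetEquality using (∼bag⇒↭)
open import Data.List.Relation.Unary.Unique.Propositional using (Unique)
open import Data.List.Relation.Unary.Unique.Propositional.Properties using (applyUpTo⁺₁)
open import Data.Nat.Base using (zero; suc; _∸_; _≤_; _<_; z≤n; s≤s; ⌊_/2⌋; ⌈_/2⌉)
open import Data.Nat.Properties
open import Data.Product.Base using (_,_; proj₁; proj₂; ∃-syntax)
open import Data.Product.Properties using (,-injective)
open import Data.Sum.Base using (_⊎_; inj₁; inj₂)
open import Data.Vec.Base using ([]; _∷_)
open import Function.Base using (_∘_)
open import Function.Bundles using (mk⇔)
open import Function.Definitions using (Injective)
open import Relation.Binary.PropositionalEquality
  using (_≢_; refl; sym; trans; cong; cong₂; subst)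
open import Relation.Nullary using (yes; no; contradiction)

-- Cardinalities of subsets

-- Induction on `m`: deleting `f zero` lowers the cardinality, and by injectivity the other values
-- survive the deletion.
injection⇒≤∣∣ : ∀ {m N} (S : Subset N) (f : Fin m → Fin N) → Injective _≡_ _≡_ f →
                (∀ i → f i ∈ˢ S) → m ≤ ∣ S ∣
injection⇒≤∣∣ {zero}  S f f-inj f∈S = z≤n
injection⇒≤∣∣ {suc m} S f f-inj f∈S = ≤-<-trans
  (injection⇒≤∣∣ (S - f zero) (f ∘ suc) (suc-injectiveᶠ ∘ f-inj)
    (λ i → x∈p∧x≢y⇒x∈p-y (f∈S (suc i)) (0≢1+nᶠ ∘ sym ∘ f-inj)))
  (x∈p⇒∣p-x∣<∣p∣ (f∈S zero))

∣p∪q∣≤∣p∣+∣q∣ : ∀ {N} (p q : Subset N) → ∣ p ∪ q ∣ ≤ ∣ p ∣ + ∣ q ∣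
∣p∪q∣≤∣p∣+∣q∣ []          []          = z≤n
∣p∪q∣≤∣p∣+∣q∣ (true  ∷ p) (true  ∷ q) =
  s≤s (≤-trans (∣p∪q∣≤∣p∣+∣q∣ p q) (+-monoʳ-≤ ∣ p ∣ (n≤1+n ∣ q ∣)))
∣p∪q∣≤∣p∣+∣q∣ (true  ∷ p) (false ∷ q) = s≤s (∣p∪q∣≤∣p∣+∣q∣ p q)
∣p∪q∣≤∣p∣+∣q∣ (false ∷ p) (true  ∷ q) =
  ≤-trans (s≤s (∣p∪q∣≤∣p∣+∣q∣ p q)) (≤-reflexive (sym (+-suc ∣ p ∣ ∣ q ∣)))
∣p∪q∣≤∣p∣+∣q∣ (false ∷ p) (false ∷ q) = ∣p∪q∣≤∣p∣+∣q∣ p q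

-- `f` may repeat values, so the size is only bounded above; this is enough for comparison with a
-- minimum.
cover : ∀ {m N} (f : Fin m → Fin N) → ∃[ S ] ∣ S ∣ ≤ m × (∀ i → f i ∈ˢ S)
cover {zero}  {N} f = ⊥ , ≤-reflexive (∣⊥∣≡0 N) , λ ()
cover {suc m} f with S , ∣S∣≤m , f∈S ← cover (f ∘ suc) = ⁅ f zero ⁆ ∪ S
  , ≤-trans (∣p∪q∣≤∣p∣+∣q∣ ⁅ f zero ⁆ S) (+-mono-≤ (≤-reflexive (∣⁅x⁆∣≡1 (f zero))) ∣S∣≤m)
  , λ { zero → p⊆p∪q S (x∈⁅x⁆ (f zero)) ; (suc i) → q⊆p∪q ⁅ f zero ⁆ S (f∈S i) }

-- Pigeonhole: with `β` naming the block of an element, a set of at most `m` elements that meets `m`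
-- blocks is exhausted by one representative per block.
module _ {A : Set} {m N : ℕ} {e : A → Fin N} (e-inj : Injective _≡_ _≡_ e)
         {S : Subset N} (∣S∣≤m : ∣ S ∣ ≤ m) (β : A → ℕ)
         (met : ∀ {t} → t < m → ∃[ x ] e x ∈ˢ S × β x ≡ t) where

  private
    rep : Fin m → A
    rep i = proj₁ (met (toℕ<n i))

    β-rep : ∀ i → β (rep i) ≡ toℕ i
    β-rep i = proj₂ (proj₂ (met (toℕ<n i)))

    rep-inj : ∀ {i j} → rep i ≡ rep j → i ≡ j
    rep-inj {i} {j} eq = toℕ-injective (trans (sym (β-rep i)) (trans (cong β eq) (β-rep j)))

    -- An element of S outside the transversal rep would be its (1 + m)-th.
    ≡rep : ∀ {x} → e x ∈ˢ S → (βx<m : β x < m) → x ≡ rep (fromℕ< βx<m)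
    ≡rep {x} x∈S βx<m with e x ≟ᶠ e (rep (fromℕ< βx<m))
    ... | yes eq = e-inj eq
    ... | no  x≢ = contradiction (≤-trans (injection⇒≤∣∣ S (e ∘ f) (f-inj ∘ e-inj) f∈S) ∣S∣≤m) 1+n≰n
      where
      f : Fin (suc m) → A
      f zero    = x
      f (suc i) = rep i

      ≢rep : ∀ i → x ≢ rep i
      ≢rep i refl = x≢ (cong (e ∘ rep)
        (toℕ-injective (trans (sym (β-rep i)) (sym (toℕ-fromℕ< βx<m)))))

      f-inj : ∀ {i j} → f i ≡ f j → i ≡ j
      f-inj {zero}  {zero}  _  = refl
      f-inj {zero}  {suc j} eq = contradiction eq (≢rep j)
      f-inj {suc i} {zero}  eq = contradiction (sym eq) (≢rep i)
      f-inj {suc i} {suc j} eq = cong suc (rep-inj eq)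

      f∈S : ∀ i → e (f i) ∈ˢ S
      f∈S zero    = x∈S
      f∈S (suc i) = proj₁ (proj₂ (met (toℕ<n i)))

  met-once : ∀ {x y} → e x ∈ˢ S → e y ∈ˢ S → β x ≡ β y → β x < m → x ≡ y
  met-once {x} {y} x∈S y∈S βx≡βy βx<m = trans (≡rep x∈S βx<m) (trans
    (cong rep (toℕ-injective (trans (toℕ-fromℕ< βx<m) (trans βx≡βy (sym (toℕ-fromℕ< βy<m))))))
    (sym (≡rep y∈S βy<m)))
    where
    βy<m : β y < m
    βy<m = subst (_< m) βx≡βy βx<m

-- Blocks of lines

⌊2*n/2⌋≡n : ∀ n → ⌊ 2 * n /2⌋ ≡ n
⌊2*n/2⌋≡n n = trans (cong (λ m → ⌊ n + m /2⌋) (+-identityʳ n)) (sym (n≡⌊n+n/2⌋ n))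

⌈2*n/2⌉≡n : ∀ n → ⌈ 2 * n /2⌉ ≡ n
⌈2*n/2⌉≡n zero    = refl
⌈2*n/2⌉≡n (suc n) = trans (cong ⌈_/2⌉ (*-suc 2 n)) (cong suc (⌈2*n/2⌉≡n n))

-- The blocks of `⌈_/2⌉` are {0}, {1 , 2}, {3 , 4} and so on; `suc n` spares a subtraction for the
-- odd member.
⌈n/2⌉≡m⇒ : ∀ n {m} → ⌈ n /2⌉ ≡ m → n ≡ 2 * m ⊎ suc n ≡ 2 * m
⌈n/2⌉≡m⇒ zero          refl = inj₁ refl
⌈n/2⌉≡m⇒ (suc zero)    refl = inj₂ refl
⌈n/2⌉≡m⇒ (suc (suc n)) refl with ⌈n/2⌉≡m⇒ n refl
... | inj₁ eq = inj₁ (trans (cong (2 +_) eq) (sym (*-suc 2 ⌈ n /2⌉)))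
... | inj₂ eq = inj₂ (trans (cong (2 +_) eq) (sym (*-suc 2 ⌈ n /2⌉)))

-- β sends a line to its block; every line but line 0 must have an adjacent line
-- in its block.
Pairing : (ℕ → ℕ) → Set
Pairing β = ∀ c → β c ≡ β (suc c) ⊎ β (suc (suc c)) ≡ β (suc c)

⌊/2⌋-pairing : Pairing ⌊_/2⌋
⌊/2⌋-pairing zero          = inj₁ refl
⌊/2⌋-pairing (suc zero)    = inj₂ refl
⌊/2⌋-pairing (suc (suc c)) with ⌊/2⌋-pairing c
... | inj₁ eq = inj₁ (cong suc eq)
... | inj₂ eq = inj₂ (cong suc eq)

⌈/2⌉-pairing : Pairing ⌈_/2⌉
-- `⌈ n /2⌉` unfolds to `⌊ suc n /2⌋`, so this is the previous pairing shifted by one line.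
⌈/2⌉-pairing c = ⌊/2⌋-pairing (suc c)

-- Applied to the coordinates of cells, which count from 1, whereas lines and
-- blocks count from 0.
data Straddle (x y z : ℕ) : Set where
  left-on  : y ≡ x → Straddle x y z
  right-on : z ≡ x → Straddle x y z
  around   : y ≡ x ∸ 1 → z ≡ x + 1 → Straddle x y z
  around′  : y ≡ x + 1 → z ≡ x ∸ 1 → Straddle x y z

row-straddle : ∀ {p q r} → Rule p q r → Straddle (proj₁ p) (proj₁ q) (proj₁ r)
row-straddle rule-a = around refl refl
row-straddle rule-b = around′ refl refl
row-straddle rule-c = around refl refl
row-straddle rule-d = left-on refl
row-straddle rule-e = left-on refl
row-straddle rule-f = left-on refl
row-straddle rule-g = right-on refl
row-straddle rule-h = right-on refl

col-straddle : ∀ {p q r} → Rule p q r → Straddle (proj₂ p) (proj₂ q) (proj₂ r)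
col-straddle rule-a = around refl refl
col-straddle rule-b = around refl refl
col-straddle rule-c = left-on refl
col-straddle rule-d = around refl refl
col-straddle rule-e = right-on refl
col-straddle rule-f = right-on refl
col-straddle rule-g = left-on refl
col-straddle rule-h = left-on refl

-- The equations are those of `around` after `suc x ∸ 1` has reduced to `x`. The first rules out
-- `x = 0`: no cell lies beyond the border line.
around-block : ∀ {β} → Pairing β → ∀ {x y z} → suc y ≡ x → suc z ≡ suc x + 1 →
               β y ≡ β x ⊎ β z ≡ β x
around-block {β} pair {y = y} {z} refl eq = subst (λ z → β y ≡ β (suc y) ⊎ β z ≡ β (suc y))
  (sym (trans (suc-injective eq) (+-comm (suc y) 1))) (pair y)

-- The invariant behind both lower bounds: one of the two sources lies in the block of the new cell.
-- Either it shares the line, or the sources occupy both adjacent lines and one of these is the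
-- partner line.
straddle-block : ∀ {β} → Pairing β → ∀ {x y z} → Straddle (suc x) (suc y) (suc z) →
                 β y ≡ β x ⊎ β z ≡ β x
straddle-block {β} pair (left-on eq)   = inj₁ (cong β (suc-injective eq))
straddle-block {β} pair (right-on eq) = inj₂ (cong β (suc-injective eq))
straddle-block     pair (around eq eq′)  = around-block pair eq eq′
straddle-block     pair (around′ eq eq′) with around-block pair eq′ eq
... | inj₁ z~x = inj₂ z~x
... | inj₂ y~x = inj₁ y~x

-- Lines met by a contaminating set of at most k + 1 cells

module Lines (k : ℕ) where

  open Grid (2 * k + 1) (2 * k + 1)

  code : Cell → Fin ((2 * k + 1) * (2 * k + 1))
  code (a , b) = combine a b

  code-injective : Injective _≡_ _≡_ code
  code-injective {a , b} {c , d} eq with refl , refl ← combine-injective a b c d eq = refl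

  2*t<n : ∀ {t} → t < suc k → 2 * t < 2 * k + 1
  2*t<n {t} (s≤s t≤k) = subst (2 * t <_) (+-comm 1 (2 * k)) (s≤s (*-monoʳ-≤ 2 t≤k))

  -- `ℓ` is the row or the column index, so one argument serves both directions; the rules enter
  -- only through `straddle`.
  module LineCounting
           {S : CellSet} (contaminating : Contaminating S) (∣S∣≤ : ∣ S ∣ ≤ suc k)
           (ℓ : Cell → ℕ) (ℓ<n : ∀ u → ℓ u < 2 * k + 1)
           (ℓ-onto : ∀ {c} → c < 2 * k + 1 → ∃[ u ] ℓ u ≡ c)
           (straddle : ∀ {u v w} → Rule (coords u) (coords v) (coords w) →
                       Straddle (suc (ℓ u)) (suc (ℓ v)) (suc (ℓ w))) where

    -- Lying in a block that `S` meets is closed under the rules, so minimality of `C S` applies.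
    block-met-from : ∀ {β} → Pairing β → ∀ {u} → C S u → ∃[ x ] x ∈ᵍ S × β (ℓ x) ≡ β (ℓ u)
    block-met-from {β} pair = C-smallest S (λ {u} u∈S → u , u∈S , refl) closed
      where
      closed : Closed (λ u → ∃[ x ] x ∈ᵍ S × β (ℓ x) ≡ β (ℓ u))
      closed r (x , x∈S , x~v) (y , y∈S , y~w) with straddle-block {β} pair (straddle r)
      ... | inj₁ v~u = x , x∈S , trans x~v v~u
      ... | inj₂ w~u = y , y∈S , trans y~w w~u

    block-met : ∀ {β} → Pairing β → (∀ t → β (2 * t) ≡ t) →
                ∀ {t} → t < suc k → ∃[ x ] x ∈ᵍ S × β (ℓ x) ≡ t
    block-met {β} pair β-even {t} t<
      -- Line `2 * t` lies in the grid and, for either kind of block, in block `t`.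
      with u , ℓu≡ ← ℓ-onto (2*t<n t<)
      with x , x∈S , x~u ← block-met-from {β} pair (contaminating u)
      = x , x∈S , trans x~u (trans (cong β ℓu≡) (β-even t))

    -- The last line `2 * k` is alone in its block within the grid, since its partner `2 * k + 1`
    -- lies outside.
    ⌊ℓ/2⌋<1+k : ∀ u → ⌊ ℓ u /2⌋ < suc k
    ⌊ℓ/2⌋<1+k u = s≤s (subst (⌊ ℓ u /2⌋ ≤_) (⌊2*n/2⌋≡n k)
      (⌊n/2⌋-mono (≤-pred (subst (ℓ u <_) (+-comm (2 * k) 1) (ℓ<n u)))))

    ⌊ℓ/2⌋-injective : ∀ {x y} → x ∈ᵍ S → y ∈ᵍ S → ⌊ ℓ x /2⌋ ≡ ⌊ ℓ y /2⌋ → x ≡ y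
    ⌊ℓ/2⌋-injective {x} x∈S y∈S eq = met-once code-injective ∣S∣≤ (λ u → ⌊ ℓ u /2⌋)
      (block-met ⌊/2⌋-pairing ⌊2*n/2⌋≡n) x∈S y∈S eq (⌊ℓ/2⌋<1+k x)

    line-injective : ∀ {x y} → x ∈ᵍ S → y ∈ᵍ S → ℓ x ≡ ℓ y → x ≡ y
    line-injective x∈S y∈S eq = ⌊ℓ/2⌋-injective x∈S y∈S (cong ⌊_/2⌋ eq)

    -- The cell found in the block {2t+1 , 2t+2} cannot lie in line 2t+1, which
    -- shares a block with line 2t.
    even-line-met : ∀ {t} → t < suc k → ∃[ x ] x ∈ᵍ S × ℓ x ≡ 2 * t
    even-line-met {t} t< with block-met ⌈/2⌉-pairing ⌈2*n/2⌉≡n t<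
    ... | y , y∈S , eq with ⌈n/2⌉≡m⇒ (ℓ y) eq
    ... | inj₁ ℓy≡ = y , y∈S , ℓy≡
    even-line-met {suc t} t< | y , y∈S , eq | inj₂ 1+ℓy≡
      with x , x∈S , ℓx≡ ← even-line-met {t} (<-trans (n<1+n t) t<)
      = contradiction (trans (sym ℓy≡) (trans (cong ℓ y≡x) ℓx≡)) 1+n≢n
      where
      ℓy≡ : ℓ y ≡ suc (2 * t)
      ℓy≡ = suc-injective (trans 1+ℓy≡ (*-suc 2 t))

      y≡x : y ≡ x
      y≡x = ⌊ℓ/2⌋-injective y∈S x∈S (trans (cong ⌊_/2⌋ ℓy≡)
        (trans (trans (⌈2*n/2⌉≡n t) (sym (⌊2*n/2⌋≡n t))) (cong ⌊_/2⌋ (sym ℓx≡))))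

    -- The block of `x` already has a cell of `S` in its even line, and `x` must be that cell.
    line-even : ∀ {x} → x ∈ᵍ S → ∃[ t ] t < suc k × ℓ x ≡ 2 * t
    line-even {x} x∈S with y , y∈S , ℓy≡ ← even-line-met (⌊ℓ/2⌋<1+k x) =
      ⌊ ℓ x /2⌋ , ⌊ℓ/2⌋<1+k x , trans (cong ℓ x≡y) ℓy≡
      where
      x≡y : x ≡ y
      x≡y = ⌊ℓ/2⌋-injective x∈S y∈S (trans (sym (⌊2*n/2⌋≡n ⌊ ℓ x /2⌋)) (cong ⌊_/2⌋ (sym ℓy≡)))

-- The diagonal solution

module Diagonal (k : ℕ) where

  open Grid (2 * k + 1) (2 * k + 1)
  open Lines k using (code; 2*t<n)

  cell : ∀ {i j} → i < 2 * k + 1 → j < 2 * k + 1 → Cell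
  cell i< j< = fromℕ< i< , fromℕ< j<

  coords-cell : ∀ {i j} (i< : i < 2 * k + 1) (j< : j < 2 * k + 1) →
                coords (cell i< j<) ≡ (suc i , suc j)
  coords-cell i< j< = cong₂ (λ i j → suc i , suc j) (toℕ-fromℕ< i<) (toℕ-fromℕ< j<)

  coords-injective : ∀ {u v} → coords u ≡ coords v → u ≡ v
  coords-injective eq with p , q ← ,-injective eq =
    cong₂ _,_ (toℕ-injective (suc-injective p)) (toℕ-injective (suc-injective q))

  diagonal : ∃[ S ] ∣ S ∣ ≤ suc k × (∀ t → code (cell (2*t<n (toℕ<n t)) (2*t<n (toℕ<n t))) ∈ˢ S)
  diagonal = cover (λ t → code (cell (2*t<n (toℕ<n t)) (2*t<n (toℕ<n t))))

  D : CellSet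
  D = proj₁ diagonal

  -- Indexing by coordinates lets positions be rewritten by arithmetic, without bound proofs inside
  -- cells.
  ContaminatedAt : ℕ × ℕ → Set
  ContaminatedAt p = ∃[ u ] coords u ≡ p × C D u

  spread-at : ∀ {i j q r} → i < 2 * k + 1 → j < 2 * k + 1 → Rule (suc i , suc j) q r →
              ContaminatedAt q → ContaminatedAt r → ContaminatedAt (suc i , suc j)
  spread-at i< j< rule (v , refl , v∈C) (w , refl , w∈C) = cell i< j< , coords-cell i< j<
    , spread (subst (λ p → Rule p (coords v) (coords w)) (sym (coords-cell i< j<)) rule) v∈C w∈C

  even-diagonal : ∀ {t} → t < suc k → ContaminatedAt (suc (2 * t) , suc (2 * t))
  even-diagonal {t} t< = u
    , trans (coords-cell 2i< 2i<) (cong (λ i → suc (2 * i) , suc (2 * i)) (toℕ-fromℕ< t<))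
    , initial (proj₂ (proj₂ diagonal) i)
    where
    i : Fin (suc k)
    i = fromℕ< t<
    2i< : 2 * toℕ i < 2 * k + 1
    2i< = 2*t<n (toℕ<n i)
    u : Cell
    u = cell 2i< 2i<

  -- An odd diagonal position lies between two even ones and follows by rule (a).
  on-diagonal : ∀ {i} → i < 2 * k + 1 → ContaminatedAt (suc i , suc i)
  on-diagonal {i} i< = by-parity (⌈n/2⌉≡m⇒ i refl) (s≤s (subst (⌈ i /2⌉ ≤_) (⌈2*n/2⌉≡n k)
    (⌈n/2⌉-mono (≤-pred (subst (i <_) (+-comm (2 * k) 1) i<)))))
    where
    by-parity : ∀ {t} → i ≡ 2 * t ⊎ suc i ≡ 2 * t → t < suc k → ContaminatedAt (suc i , suc i)
    by-parity (inj₁ i≡) t< = subst (λ c → ContaminatedAt (suc c , suc c)) (sym i≡) (even-diagonal t<)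
    by-parity {suc t} (inj₂ 1+i≡) t< = spread-at i< i< rule-a
      (subst (λ c → ContaminatedAt (c , c)) (suc-injective (trans (sym (*-suc 2 t)) (sym 1+i≡)))
        (even-diagonal (<-trans (n<1+n t) t<)))
      (subst (λ c → ContaminatedAt (suc c , suc c)) (trans (sym 1+i≡) (+-comm 1 i))
        (even-diagonal t<))

  -- Induction on the distance `d` from the diagonal: the left and lower neighbours are one step
  -- nearer to it.
  above-diagonal : ∀ d {i} → i + d < 2 * k + 1 → ContaminatedAt (suc i , suc (i + d))
  above-diagonal zero    {i} j< = subst (λ j → ContaminatedAt (suc i , suc j))
    (sym (+-identityʳ i)) (on-diagonal (subst (_< 2 * k + 1) (+-identityʳ i) j<))
  above-diagonal (suc d) {i} j< = spread-at (≤-<-trans (m≤m+n i (suc d)) j<) j< rule-f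
    (subst (λ j → ContaminatedAt (suc i , j)) (sym (+-suc i d))
      (above-diagonal d (<-trans (n<1+n (i + d)) (subst (_< 2 * k + 1) (+-suc i d) j<))))
    (subst (λ j → ContaminatedAt (suc (i + 1) , suc j)) (+-assoc i 1 d)
      (above-diagonal d (subst (_< 2 * k + 1) (sym (+-assoc i 1 d)) j<)))

  -- Mirror image: here the upper and right neighbours are nearer to the diagonal.
  below-diagonal : ∀ d {j} → j + d < 2 * k + 1 → ContaminatedAt (suc (j + d) , suc j)
  below-diagonal zero    {j} i< = subst (λ i → ContaminatedAt (suc i , suc j))
    (sym (+-identityʳ j)) (on-diagonal (subst (_< 2 * k + 1) (+-identityʳ j) i<))
  below-diagonal (suc d) {j} i< = spread-at i< (≤-<-trans (m≤m+n j (suc d)) i<) rule-h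
    (subst (λ i → ContaminatedAt (i , suc j)) (sym (+-suc j d))
      (below-diagonal d (<-trans (n<1+n (j + d)) (subst (_< 2 * k + 1) (+-suc j d) i<))))
    (subst (λ i → ContaminatedAt (suc i , suc (j + 1))) (+-assoc j 1 d)
      (below-diagonal d (subst (_< 2 * k + 1) (sym (+-assoc j 1 d)) i<)))

  contaminatedAt : ∀ {i j} → i < 2 * k + 1 → j < 2 * k + 1 → ContaminatedAt (suc i , suc j)
  contaminatedAt {i} {j} i< j< with ≤-total i j
  ... | inj₁ i≤j = subst (λ j → ContaminatedAt (suc i , suc j)) (m+[n∸m]≡n i≤j)
    (above-diagonal (j ∸ i) (subst (_< 2 * k + 1) (sym (m+[n∸m]≡n i≤j)) j<))
  ... | inj₂ j≤i = subst (λ i → ContaminatedAt (suc i , suc j)) (m+[n∸m]≡n j≤i)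
    (below-diagonal (i ∸ j) (subst (_< 2 * k + 1) (sym (m+[n∸m]≡n j≤i)) i<))

  contaminating : Contaminating D
  contaminating (a , b) with v , eq , v∈C ← contaminatedAt (toℕ<n a) (toℕ<n b) =
    subst (C D) (coords-injective eq) v∈C

  -- Minimality of `∣ S ∣` enters only here, by comparison with `D`.
  optimal⇒∣∣≤1+k : ∀ {S} → OptimalSolution S → ∣ S ∣ ≤ suc k
  optimal⇒∣∣≤1+k (_ , isγ) = ≤-trans
    (IsPowerContaminationNumber.minimal isγ D contaminating) (proj₁ (proj₂ diagonal))

-- Permutations

odd∈odds : ∀ {k t} → t < suc k → suc (2 * t) ∈ odds k
odd∈odds {k} {t} t< = subst (_∈ odds k) (+-comm (2 * t) 1) (∈-applyUpTo⁺ (λ t → 2 * t + 1) t<)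

odds∋⇒odd : ∀ {k j} → j ∈ odds k → ∃[ t ] t < suc k × j ≡ suc (2 * t)
odds∋⇒odd j∈ with t , t< , refl ← ∈-applyUpTo⁻ (λ t → 2 * t + 1) j∈ = t , t< , +-comm (2 * t) 1

2*n+1-injective : ∀ s t → 2 * s + 1 ≡ 2 * t + 1 → s ≡ t
2*n+1-injective s t eq = *-cancelˡ-≡ s t 2 (+-cancelʳ-≡ 1 (2 * s) (2 * t) eq)

odds-unique : ∀ k → Unique (odds k)
odds-unique k = applyUpTo⁺₁ (λ t → 2 * t + 1) (suc k) λ {s} {t} s<t _ → <⇒≢ s<t ∘ 2*n+1-injective s t

map-odds-unique : ∀ k (f : ℕ → ℕ) →
                  (∀ {i j} → i ∈ odds k → j ∈ odds k → f i ≡ f j → i ≡ j) →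
                  Unique (map f (odds k))
map-odds-unique k f f-inj = subst Unique (sym (map-applyUpTo (λ t → 2 * t + 1) f (suc k)))
  (applyUpTo⁺₁ (λ t → f (2 * t + 1)) (suc k) λ {s} {t} s<t t< f≡ → <⇒≢ s<t (2*n+1-injective s t
    (f-inj (∈-applyUpTo⁺ (λ t → 2 * t + 1) (<-trans s<t t<)) (∈-applyUpTo⁺ (λ t → 2 * t + 1) t<) f≡)))

-- Two duplicate-free lists with the same members are equal as bags, hence permutations of each
-- other.
map-odds-↭ : ∀ k (f : ℕ → ℕ) → (∀ {j} → j ∈ odds k → f j ∈ odds k) →
             (∀ {i j} → i ∈ odds k → j ∈ odds k → f i ≡ f j → i ≡ j) →
             (∀ {i} → i ∈ odds k → ∃[ j ] j ∈ odds k × i ≡ f j) →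
             map f (odds k) ↭ odds k
map-odds-↭ k f f∈ f-inj f-onto =
  ∼bag⇒↭ (unique∧set⇒bag (map-odds-unique k f f-inj) (odds-unique k) (mk⇔ to from))
  where
  to : ∀ {i} → i ∈ map f (odds k) → i ∈ odds k
  to i∈ with j , j∈ , refl ← ∈-map⁻ f i∈ = f∈ j∈

  from : ∀ {i} → i ∈ odds k → i ∈ map f (odds k)
  from i∈ with j , j∈ , refl ← f-onto i∈ = ∈-map⁺ f j∈

-- Rows and columns of an optimal solution

module Optimal (k : ℕ) (S : Grid.CellSet (2 * k + 1) (2 * k + 1))
               (optimal : Grid.OptimalSolution (2 * k + 1) (2 * k + 1) S) where

  open Grid (2 * k + 1) (2 * k + 1)
  open Lines k

  ∣S∣≤ : ∣ S ∣ ≤ suc k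
  ∣S∣≤ = Diagonal.optimal⇒∣∣≤1+k k optimal

  row col : Cell → ℕ
  row = toℕ ∘ proj₁
  col = toℕ ∘ proj₂

  row-onto : ∀ {c} → c < 2 * k + 1 → ∃[ u ] row u ≡ c
  row-onto c< = (fromℕ< c< , fromℕ< c<) , toℕ-fromℕ< c<

  col-onto : ∀ {c} → c < 2 * k + 1 → ∃[ u ] col u ≡ c
  col-onto c< = (fromℕ< c< , fromℕ< c<) , toℕ-fromℕ< c<

  module Row = LineCounting (proj₁ optimal) ∣S∣≤ row (toℕ<n ∘ proj₁) row-onto row-straddle
  module Col = LineCounting (proj₁ optimal) ∣S∣≤ col (toℕ<n ∘ proj₂) col-onto col-straddle

  row-injective : ∀ {i j j′} → Occupied S i j → Occupied S i j′ → j ≡ j′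
  row-injective (u , u≡ , u∈S) (v , v≡ , v∈S) =
    trans (sym (cong proj₂ u≡)) (trans (cong (suc ∘ col) u≡v) (cong proj₂ v≡))
    where
    u≡v : u ≡ v
    u≡v = Row.line-injective u∈S v∈S (suc-injective (trans (cong proj₁ u≡) (sym (cong proj₁ v≡))))

  col-injective : ∀ {i i′ j} → Occupied S i j → Occupied S i′ j → i ≡ i′
  col-injective (u , u≡ , u∈S) (v , v≡ , v∈S) =
    trans (sym (cong proj₁ u≡)) (trans (cong (suc ∘ row) u≡v) (cong proj₁ v≡))
    where
    u≡v : u ≡ v
    u≡v = Col.line-injective u∈S v∈S (suc-injective (trans (cong proj₂ u≡) (sym (cong proj₂ v≡))))

  row-odd : ∀ {i j} → Occupied S i j → i ∈ odds k
  row-odd (u , u≡ , u∈S) = let t , t< , eq = Row.line-even u∈S in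
    subst (_∈ odds k) (trans (cong suc (sym eq)) (cong proj₁ u≡)) (odd∈odds t<)

  col-odd : ∀ {i j} → Occupied S i j → j ∈ odds k
  col-odd (u , u≡ , u∈S) = let t , t< , eq = Col.line-even u∈S in
    subst (_∈ odds k) (trans (cong suc (sym eq)) (cong proj₂ u≡)) (odd∈odds t<)

  row-met : ∀ {i} → i ∈ odds k → ∃[ j ] Occupied S i j
  row-met i∈ =
    let t , t< , i≡     = odds∋⇒odd i∈
        u , u∈S , row≡ = Row.even-line-met t<
    in suc (col u) , u , cong (_, suc (col u)) (trans (cong suc row≡) (sym i≡)) , u∈S

  col-met : ∀ {j} → j ∈ odds k → ∃[ i ] Occupied S i j
  col-met j∈ =
    let t , t< , j≡     = odds∋⇒odd j∈
        u , u∈S , col≡ = Col.even-line-met t<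
    in suc (row u) , u , cong (suc (row u) ,_) (trans (cong suc col≡) (sym j≡)) , u∈S

proposition9 : ∀ (k : ℕ) → k ≥ 1 →
    let open Grid (2 * k + 1) (2 * k + 1) in
    ∀ (S : CellSet) → OptimalSolution S →
    (∀ j → j ∈ odds k → ∃! _≡_ (λ i → Occupied S i j))
    × (∀ i j → Occupied S i j → j ∈ odds k)
    × (∀ (i : ℕ → ℕ) → (∀ j → j ∈ odds k → Occupied S (i j) j) →
    map i (odds k) ↭ odds k)
proposition9 k _ S optimal =
    (λ j j∈ → let i , occ = col-met j∈ in i , occ , col-injective occ)
  , (λ i j → col-odd)
  , (λ f occ → map-odds-↭ k f
      (λ j∈ → row-odd (occ _ j∈))
      -- Equal values put two cells of `S` in one row, which holds only one.
      (λ i∈ j∈ fi≡fj → row-injective (occ _ i∈)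
        (subst (λ r → Occupied S r _) (sym fi≡fj) (occ _ j∈)))
      -- The cell of `S` in row `i` has an odd column `j`, whose unique occupied row is also `f j`.
      (λ i∈ → let j , i~j = row-met i∈ in
        j , col-odd i~j , col-injective i~j (occ j (col-odd i~j))))
  where
  open Grid (2 * k + 1) (2 * k + 1)
  open Optimal k S optimal
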